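{- Every GaTEx graph is a comparability graph.
   Context: All graphs are finite, simple and undirected. A galled-tree on a finite nonempty set $X$ is a directed acyclic graph $N=(V,E)$ such that either $V=X=\{x\}$ and $E=\emptyset$, or: (N1) there is a unique root with indegree 0 and outdegree at least 2; (N2) $x\in X$ iff $x$ has outdegree 0 and indegree 1; (N3) every non-root $v\in V\setminus X$ has either indegree 1 and outdegree at least 2, or indegree 2 and outdegree at least 1 (hybrid-vertex); (N4) each biconnected component $C$ of $N$ contains at most one hybrid-vertex whose two in-neighbours both belong to $C$. For $x,y\in X$, $\mathrm{lca}_N(x,y)$ is the (unique) minimal common ancestor of $x,y$. A labeled galled-tree $(N,t)$ has $t:V\to\{0,1,\odot\}$ with $t(x)=\odot$ iff $x\in X$; it explains the graph on $X$ where $\{x,y\}$ is an edge iff $t(\mathrm{lca}_N(x,y))=1$. A graph is GaTEx if it is isomorphic to a graph explained by some labeled galled-tree. A comparability graph is a graph admitting a transitive orientation: an orientation of every edge such that arcs $(x,y)$ and $(y,z)$ imply the arc $(x,z)$. -}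

module Defs where

open import Data.Nat using (ℕ; _≥_)
open import Data.Fin using (Fin)
open import Data.Bool using (Bool; true; false)
open import Data.List using (List; length; filterᵇ)
open import Data.List using () renaming (map to mapL)
open import Data.Fin.Base using ()
open import Data.List.Base using ()
open import Data.Product using (Σ; _×_; ∃)
open import Data.Sum using (_⊎_)
open import Relation.Nullary using (¬_)
open import Relation.Binary.PropositionalEquality using (_≡_; _≢_)
open import Relation.Binary.Construct.Closure.ReflexiveTransitive using (Star)
open import Relation.Binary.Construct.Closure.Transitive using (TransClosure)
import Data.List as L
open import Data.Fin using (Fin)
open import Data.List.Base using (List)

record Graph (k : ℕ) : Set₁ where
  field
    adj     : Fin k → Fin k → Set
    adj-sym : ∀ x y → adj x y → adj y x
    adj-irr : ∀ x → ¬ adj x x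
open Graph public

IsComparability : ∀ {k} → Graph k → Set₁
IsComparability {k} G =
  Σ (Fin k → Fin k → Set) λ O →
    (∀ x y → O x y → adj G x y)
  × (∀ x y → adj G x y → O x y ⊎ O y x)
  × (∀ x y → O x y → ¬ O y x)
  × (∀ x y z → O x y → O y z → O x z)

allFinL : (n : ℕ) → List (Fin n)
allFinL n = Data.List.Base.tabulate {n = n} (λ i → i)
  where import Data.List.Base

Arc : ∀ {n} → (Fin n → Fin n → Bool) → Fin n → Fin n → Set
Arc A u v = A u v ≡ true

indeg : ∀ {n} → (Fin n → Fin n → Bool) → Fin n → ℕ
indeg {n} A v = length (filterᵇ (λ u → A u v) (allFinL n))

outdeg : ∀ {n} → (Fin n → Fin n → Bool) → Fin n → ℕ
outdeg {n} A v = length (filterᵇ (λ w → A v w) (allFinL n))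

Acyclic : ∀ {n} → (Fin n → Fin n → Bool) → Set
Acyclic A = ∀ v → ¬ TransClosure (Arc A) v v

UEdgeIn : ∀ {n} → (Fin n → Fin n → Bool) → (Fin n → Set) → Fin n → Fin n → Set
UEdgeIn A S a b = S a × S b × (Arc A a b ⊎ Arc A b a)

ConnectedOn : ∀ {n} → (Fin n → Fin n → Bool) → (Fin n → Set) → Set
ConnectedOn A S = ∀ u w → S u → S w → Star (UEdgeIn A S) u w

Biconnected : ∀ {n} → (Fin n → Fin n → Bool) → (Fin n → Set) → Set
Biconnected A C =
  (∃ λ v → C v) × ConnectedOn A C
  × (∀ v → C v → ConnectedOn A (λ u → C u × u ≢ v))

BiconnectedComponent : ∀ {n} → (Fin n → Fin n → Bool) → (Fin n → Set) → Set₁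
BiconnectedComponent {n} A C =
  Biconnected A C
  × (∀ (D : Fin n → Set) → Biconnected A D → (∀ u → C u → D u) → ∀ u → D u → C u)

HybridOf : ∀ {n} → (Fin n → Fin n → Bool) → (Fin n → Set) → Fin n → Set
HybridOf A C h = C h × indeg A h ≡ 2 × (∀ u → Arc A u h → C u)

IsGalledTree : ∀ {n} → (Fin n → Fin n → Bool) → (Fin n → Set) → Set₁
IsGalledTree {n} A X =
  (n ≡ 1 × (∀ v → X v) × (∀ u v → A u v ≡ false))
  ⊎
  ( Acyclic A
  × (Σ (Fin n) λ r →
        indeg A r ≡ 0 × outdeg A r ≥ 2 × (∀ v → indeg A v ≡ 0 → v ≡ r)
      × (∀ v → v ≢ r → ¬ X v →
           (indeg A v ≡ 1 × outdeg A v ≥ 2) ⊎ (indeg A v ≡ 2 × outdeg A v ≥ 1)))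
  × (∀ x → (X x → outdeg A x ≡ 0 × indeg A x ≡ 1)
         × (outdeg A x ≡ 0 × indeg A x ≡ 1 → X x))
  × (∀ C → BiconnectedComponent A C →
       ∀ h h' → HybridOf A C h → HybridOf A C h' → h ≡ h'))

Ancestor : ∀ {n} → (Fin n → Fin n → Bool) → Fin n → Fin n → Set
Ancestor A = Star (Arc A)

CommonAncestor : ∀ {n} → (Fin n → Fin n → Bool) → Fin n → Fin n → Fin n → Set
CommonAncestor A w x y = Ancestor A w x × Ancestor A w y

IsLCA : ∀ {n} → (Fin n → Fin n → Bool) → Fin n → Fin n → Fin n → Set
IsLCA A w x y =
  CommonAncestor A w x y
  × (∀ w' → CommonAncestor A w' x y → Ancestor A w w' → w' ≡ w)

data Label : Set where
  lab0 lab1 labOdot : Label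

-- G is GaTEx: G is isomorphic (via ι, a bijection from Fin k onto the leaf set X)
-- to the graph explained by a labeled galled-tree (A, t) on X.
IsGaTEx : ∀ {k} → Graph k → Set₁
IsGaTEx {k} G =
  Σ ℕ λ n →
  Σ (Fin n → Fin n → Bool) λ A →
  Σ (Fin n → Set) λ X →
  Σ (Fin k → Fin n) λ ι →
  Σ (Fin n → Label) λ t →
    IsGalledTree A X
  × (∀ i j → ι i ≡ ι j → i ≡ j)
  × (∀ v → X v → Σ (Fin k) λ i → ι i ≡ v)
  × (∀ i → X (ι i))
  × (∀ v → (t v ≡ labOdot → X v) × (X v → t v ≡ labOdot))
  × (∀ i j → i ≢ j →
       (adj G i j → Σ (Fin n) λ w → IsLCA A w (ι i) (ι j) × t w ≡ lab1)
     × ((Σ (Fin n) λ w → IsLCA A w (ι i) (ι j) × t w ≡ lab1) → adj G i j))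

{-# OPTIONS --safe #-}

-- It suffices to order the vertices so that the edges, directed upwards in the order, are
-- transitive; such an order is built bottom-up on the leaves below each vertex v.  The one-hybrid
-- condition makes a vertex strictly inside a cycle determine the hybrid closing that cycle.
-- Hence lowest common ancestors are unique, and the children of v with common descendants come
-- in pairs, each pair spanning a cycle with root v.  Different groups of children are uniformly
-- joined by t(v).  For a cycle with hybrid part H and sides S and T, a vertex of S has the same
-- adjacency to H as to everything further down its side.  So each side can be ordered from top
-- to bottom, and the cycle as S < H < reverse T if t(v) = 1, and as H < reverse S < reverse T
-- otherwise.

module Submission where

open import Defs
open import Data.Bool using (Bool; true; T?)
open import Data.Bool.Properties using (T-≡) renaming (_≟_ to _≟ᵇ_)
open import Data.Empty using (⊥)
open import Data.Fin using (Fin; zero; _≟_)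
open import Data.Fin.Induction using (spo-wellFounded; spo-noetherian)
open import Data.Fin.Properties using (any?)
open import Data.List using (List; []; _∷_; length; filterᵇ; allFin)
open import Data.List.Membership.Propositional using (_∈_; find; lose)
open import Data.List.Membership.Propositional.Properties
  using (∈-allFin; ∈-tabulate⁺; ∈-filter⁺; ∈-filter⁻)
open import Data.List.Relation.Unary.All using (All; []; _∷_)
open import Data.List.Relation.Unary.All.Properties using (¬Any⇒All¬)
import Data.List.Relation.Unary.Any as Any
open Any using (here; there)
open import Data.Nat using (ℕ)
open import Data.Product using (∃; ∃₂; _×_; _,_; proj₁; proj₂; swap; map₁; map₂)
open import Data.Sum using (_⊎_; inj₁; inj₂; [_,_]′) renaming (swap to ⊎-swap)
open import Data.Unit using (⊤)
open import Function using (_∘_; id; flip; Equivalence)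
open import Induction.WellFounded using (WellFounded; Acc; acc)
open import Relation.Binary.Construct.Closure.ReflexiveTransitive
  using (Star; ε; _◅_; _◅◅_; gmap; reverse)
open import Relation.Binary.Construct.Closure.Transitive
  using (TransClosure; [_]; _∷_; _++_)
open import Relation.Binary.PropositionalEquality
  using (_≡_; _≢_; refl; sym; trans; subst; isEquivalence; ≢-sym)
open import Relation.Binary.Structures using (IsStrictPartialOrder)
open import Relation.Nullary using (¬_; Dec; yes; no)
open import Relation.Nullary.Decidable using (_×-dec_; ¬?; map′)
open import Relation.Nullary.Negation using (contradiction)
open import Relation.Unary using (Pred; _⊆_; _∪_; _∖_)
open import Level using (0ℓ)

-- Short lists and degree counts

module _ {A : Set} where

  length≡0⇒∉ : ∀ {x : A} {xs} → length xs ≡ 0 → ¬ x ∈ xs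
  length≡0⇒∉ {xs = []} _ ()

  length≡1⇒≡ : ∀ {x y : A} {xs} → length xs ≡ 1 → x ∈ xs → y ∈ xs → x ≡ y
  length≡1⇒≡ {xs = _ ∷ []} _ (here refl) (here refl) = refl

  length≡2⇒≡⊎≡ : ∀ {x y z : A} {xs} → length xs ≡ 2 → x ≢ y →
                 x ∈ xs → y ∈ xs → z ∈ xs → z ≡ x ⊎ z ≡ y
  length≡2⇒≡⊎≡ {xs = _ ∷ _ ∷ []} _ _ (here refl) _ (here refl) = inj₁ refl
  length≡2⇒≡⊎≡ {xs = _ ∷ _ ∷ []} _ _ _ (here refl) (here refl) = inj₂ refl
  length≡2⇒≡⊎≡ {xs = _ ∷ _ ∷ []} _ _ (there (here refl)) _ (there (here refl)) = inj₁ refl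
  length≡2⇒≡⊎≡ {xs = _ ∷ _ ∷ []} _ _ _ (there (here refl)) (there (here refl)) = inj₂ refl
  length≡2⇒≡⊎≡ {xs = _ ∷ _ ∷ []} _ x≢y (here refl) (here refl) _ = contradiction refl x≢y
  length≡2⇒≡⊎≡ {xs = _ ∷ _ ∷ []} _ x≢y (there (here refl)) (there (here refl)) _ =
    contradiction refl x≢y

module _ {n : ℕ} (f : Fin n → Bool) where

  ∈-filterᵇ-allFinL : ∀ {x} → f x ≡ true → x ∈ filterᵇ f (allFinL n)
  ∈-filterᵇ-allFinL {x} fx =
    ∈-filter⁺ (T? ∘ f) (∈-tabulate⁺ x) (Equivalence.from T-≡ fx)

  length-filterᵇ≡0? : length (filterᵇ f (allFinL n)) ≡ 0 ⊎ ∃ λ x → f x ≡ true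
  length-filterᵇ≡0? with filterᵇ f (allFinL n) in eq
  ... | []    = inj₁ refl
  ... | x ∷ _ = inj₂ (x , Equivalence.to T-≡
      (proj₂ (∈-filter⁻ (T? ∘ f) {xs = allFinL n} (subst (x ∈_) (sym eq) (here refl)))))

-- Blocks

module Blocks {n : ℕ} (A : Fin n → Fin n → Bool) where

  Edge : Fin n → Fin n → Set
  Edge x y = Arc A x y ⊎ Arc A y x

  Avoiding : Fin n → Fin n → Fin n → Set
  Avoiding z = Star (UEdgeIn A (_≢ z))

  UEdgeIn-sym : ∀ {S : Fin n → Set} {x y} → UEdgeIn A S x y → UEdgeIn A S y x
  UEdgeIn-sym (sx , sy , e) = sy , sx , ⊎-swap e

  Avoiding-sym : ∀ {z x y} → Avoiding z x y → Avoiding z y x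
  Avoiding-sym = reverse UEdgeIn-sym

  -- The block of the edge ab: the vertices that no single vertex separates from ab.
  Block : Fin n → Fin n → Fin n → Set
  Block a b u = ∀ z → u ≢ z → (a ≢ z → Avoiding z u a) × (b ≢ z → Avoiding z u b)

  Block-swap : ∀ {a b u} → Block a b u → Block b a u
  Block-swap bu z u≢z = swap (bu z u≢z)

  Block-left : ∀ {a b} → Edge a b → Block a b a
  Block-left e z a≢z = (λ _ → ε) , λ b≢z → (a≢z , b≢z , e) ◅ ε

  -- At most one of `c` and `d` is the removed vertex; the other one relays the paths from `u` to
  -- `a` and to `b`.
  Block-trans : ∀ {a b c d u} → c ≢ d → Block a b c → Block a b d → Block c d u → Block a b u
  Block-trans {c = c} c≢d bc bd bu z u≢z with c ≟ z
  ... | no c≢z = (λ a≢z → proj₁ (bu z u≢z) c≢z ◅◅ proj₁ (bc z c≢z) a≢z)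
               , (λ b≢z → proj₁ (bu z u≢z) c≢z ◅◅ proj₂ (bc z c≢z) b≢z)
  ... | yes refl = (λ a≢z → proj₂ (bu _ u≢z) d≢c ◅◅ proj₁ (bd _ d≢c) a≢z)
                 , (λ b≢z → proj₂ (bu _ u≢z) d≢c ◅◅ proj₂ (bd _ d≢c) b≢z)
    where d≢c = ≢-sym c≢d

  -- Unless `s` is removed, `s` itself links `y` to both ends of the edge; the given path settles
  -- the removal of `s`.
  Block-adjacent-edge : ∀ {s x y} → Edge s x → Edge s y → Avoiding s x y → Block s x y
  Block-adjacent-edge {s} {x} {y} sx sy x⇝y z y≢z with s ≟ z
  ... | yes refl = (λ s≢s → contradiction refl s≢s) , λ _ → Avoiding-sym x⇝y
  ... | no s≢z = (λ _ → ys ◅ ε) , λ x≢z → ys ◅ (s≢z , x≢z , sx) ◅ ε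
    where ys = y≢z , s≢z , ⊎-swap sy

  -- SimplePath z a x vs: a path from x to a that avoids z and visits the vertices vs once each.
  data SimplePath (z a : Fin n) : Fin n → List (Fin n) → Set where
    done : SimplePath z a a (a ∷ [])
    step : ∀ {x y vs} → UEdgeIn A (_≢ z) x y → All (x ≢_) vs → SimplePath z a y vs →
           SimplePath z a x (x ∷ vs)

  SimplePath-suffix : ∀ {z a x y vs} → SimplePath z a x vs → y ∈ vs → ∃ (SimplePath z a y)
  SimplePath-suffix done (here refl) = _ , done
  SimplePath-suffix p@(step _ _ _) (here refl) = _ , p
  SimplePath-suffix (step _ _ p) (there i) = SimplePath-suffix p i

  simplify : ∀ {z a x} → Avoiding z x a → ∃ (SimplePath z a x)
  simplify ε = _ , done
  simplify {x = x} (e ◅ p) with simplify p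
  ... | vs , q with Any.any? (x ≟_) vs
  ...   | yes x∈vs = SimplePath-suffix q x∈vs
  ...   | no x∉vs = _ , step e (¬Any⇒All¬ vs x∉vs) q

  SimplePath-avoids : ∀ {z a x y vs} → SimplePath z a x vs → All (y ≢_) vs → Avoiding y x a
  SimplePath-avoids done _ = ε
  SimplePath-avoids (step e _ p) (y≢x ∷ fresh) =
    (≢-sym y≢x , head p fresh , proj₂ (proj₂ e)) ◅ SimplePath-avoids p fresh
    where
    head : ∀ {z a x y vs} → SimplePath z a x vs → All (y ≢_) vs → x ≢ y
    head done (y≢x ∷ _) = ≢-sym y≢x
    head (step _ _ _) (y≢x ∷ _) = ≢-sym y≢x

  SimplePath-target≢ : ∀ {z a x y vs} → SimplePath z a x vs → All (y ≢_) vs → a ≢ y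
  SimplePath-target≢ done (y≢a ∷ _) = ≢-sym y≢a
  SimplePath-target≢ (step _ _ p) (_ ∷ fresh) = SimplePath-target≢ p fresh

  InBlockAvoiding : Fin n → Fin n → Fin n → Fin n → Fin n → Set
  InBlockAvoiding a b z = Star (UEdgeIn A (λ u → Block a b u × u ≢ z))

  -- A simple path that left the block through a cut vertex would have to return through it.
  SimplePath-in-Block : ∀ {a b z x vs} → Edge a b → Block a b x → SimplePath z a x vs →
                        InBlockAvoiding a b z x a
  SimplePath-in-Block ab bx done = ε
  SimplePath-in-Block {a} {b} ab bx (step {x} {y} (x≢z , y≢z , xy) fresh p) =
    ((bx , x≢z) , (by , y≢z) , xy) ◅ SimplePath-in-Block ab by p
    where
    by : Block a b y
    by z′ y≢z′ with x ≟ z′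
    ... | no x≢z′ = (λ a≢z′ → yx ◅ proj₁ (bx z′ x≢z′) a≢z′) , (λ b≢z′ → yx ◅ proj₂ (bx z′ x≢z′) b≢z′)
      where yx = y≢z′ , x≢z′ , ⊎-swap xy
    ... | yes refl = (λ _ → y⇝a) , λ b≢x → y⇝a ◅◅ ((SimplePath-target≢ p fresh , b≢x , ab) ◅ ε)
      where y⇝a = SimplePath-avoids p fresh

  path-in-Block : ∀ {a b z u} → Edge a b → Block a b u → u ≢ z → a ≢ z → InBlockAvoiding a b z u a
  path-in-Block ab bu u≢z a≢z =
    SimplePath-in-Block ab bu (proj₂ (simplify (proj₁ (bu _ u≢z) a≢z)))

  -- All vertices are joined to the hub `a`; if `a` is the removed vertex, `b` takes its place.
  Block-connected-avoiding : ∀ {a b} → Edge a b → a ≢ b → ∀ z →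
                             ConnectedOn A (λ u → Block a b u × u ≢ z)
  Block-connected-avoiding {a} {b} ab a≢b z u w (bu , u≢z) (bw , w≢z) with a ≟ z
  ... | no a≢z = path-in-Block ab bu u≢z a≢z
                 ◅◅ reverse UEdgeIn-sym (path-in-Block ab bw w≢z a≢z)
  ... | yes refl = gmap id unswap
      (path-in-Block ba (Block-swap bu) u≢z b≢a
       ◅◅ reverse UEdgeIn-sym (path-in-Block ba (Block-swap bw) w≢z b≢a))
    where
    ba = ⊎-swap ab
    b≢a = ≢-sym a≢b
    unswap : ∀ {x y} → UEdgeIn A (λ u → Block b a u × u ≢ a) x y →
             UEdgeIn A (λ u → Block a b u × u ≢ a) x y
    unswap ((bx , x≢) , (by , y≢) , e) = (Block-swap bx , x≢) , (Block-swap by , y≢) , e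

  Block-connected : ∀ {a b} → Edge a b → a ≢ b → ConnectedOn A (Block a b)
  Block-connected {a} {b} ab a≢b u w bu bw = to-a bu ◅◅ reverse UEdgeIn-sym (to-a bw)
    where
    to-a : ∀ {u} → Block a b u → Star (UEdgeIn A (Block a b)) u a
    to-a {u} bu with u ≟ b
    ... | yes refl = (bu , Block-left ab , ⊎-swap ab) ◅ ε
    -- Any vertex other than `u` and `a` could be avoided here; `b` is one.
    ... | no u≢b = gmap id (λ { ((bx , _) , (by , _) , e) → bx , by , e })
                     (path-in-Block ab bu u≢b a≢b)

  -- This makes the one-hybrid condition applicable to the block of an edge. For maximality, a
  -- biconnected `D` containing the edge joins each of its vertices to `a` and `b` around any `z`,
  -- as `Block` demands.
  Block-component : ∀ {a b} → Edge a b → a ≢ b → BiconnectedComponent A (Block a b)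
  Block-component {a} {b} ab a≢b =
    ((a , Block-left ab) , Block-connected ab a≢b , λ z _ → Block-connected-avoiding ab a≢b z)
    , maximal
    where
    maximal : ∀ D → Biconnected A D → (∀ u → Block a b u → D u) → ∀ u → D u → Block a b u
    maximal D (_ , conn , conn-avoiding) B⊆D u du z u≢z =
      avoid (B⊆D a (Block-left ab)) , avoid (B⊆D b (Block-swap (Block-left (⊎-swap ab))))
      where
      scan : ∀ {x y} → x ≢ z → Star (UEdgeIn A D) x y → D z ⊎ Avoiding z x y
      scan _ ε = inj₂ ε
      scan x≢z (_◅_ {j = y} (_ , dy , e) p) with y ≟ z
      ... | yes refl = inj₁ dy
      ... | no y≢z with scan y≢z p
      ...   | inj₁ dz = inj₁ dz
      ...   | inj₂ q = inj₂ ((x≢z , y≢z , e) ◅ q)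

      forget : ∀ {x y} → UEdgeIn A (λ u → D u × u ≢ z) x y → UEdgeIn A (_≢ z) x y
      forget ((_ , x≢z) , (_ , y≢z) , e) = x≢z , y≢z , e

      -- D z need not be decidable, but a path through z exhibits it.
      avoid : ∀ {c} → D c → c ≢ z → Avoiding z u c
      avoid {c} dc c≢z with scan u≢z (conn u c du dc)
      ... | inj₁ dz = gmap id forget (conn-avoiding z dz u c (du , u≢z) (dc , c≢z))
      ... | inj₂ q = q

-- Vertex orders inducing transitive orientations

module Orders {k : ℕ} (G : Graph k) where

  Subset : Set₁
  Subset = Pred (Fin k) 0ℓ

  Disjoint : Subset → Subset → Set
  Disjoint S T = ∀ {x} → S x → ¬ T x

  data Uniform (S T : Subset) : Set where
    joined   : (∀ {x y} → S x → T y → adj G x y) → Uniform S T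
    unjoined : (∀ {x y} → S x → T y → ¬ adj G x y) → Uniform S T

  Uniform-mono : ∀ {S T S′ T′} → S′ ⊆ S → T′ ⊆ T → Uniform S T → Uniform S′ T′
  Uniform-mono f g (joined u) = joined λ s t → u (f s) (g t)
  Uniform-mono f g (unjoined u) = unjoined λ s t → u (f s) (g t)

  -- The laws bind `lt` only on `S`, so a subset inherits the very same relation.
  record Ordering (S : Subset) : Set₁ where
    field
      lt         : Fin k → Fin k → Set
      total      : ∀ {x y} → S x → S y → x ≢ y → lt x y ⊎ lt y x
      asym       : ∀ {x y} → S x → S y → lt x y → ¬ lt y x
      lt-trans   : ∀ {x y z} → S x → S y → S z → lt x y → lt y z → lt x z
      adj-trans  : ∀ {x y z} → S x → S y → S z → lt x y → lt y z →
                   adj G x y → adj G y z → adj G x z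
  open Ordering

  subordering : ∀ {S T} → T ⊆ S → Ordering S → Ordering T
  subordering f o = record
    { lt = lt o
    ; total = λ s t → total o (f s) (f t)
    ; asym = λ s t → asym o (f s) (f t)
    ; lt-trans = λ s t u → lt-trans o (f s) (f t) (f u)
    ; adj-trans = λ s t u → adj-trans o (f s) (f t) (f u)
    }

  dual : ∀ {S} → Ordering S → Ordering S
  dual o = record
    { lt = flip (lt o)
    ; total = λ s t x≢y → ⊎-swap (total o s t x≢y)
    ; asym = λ s t → asym o t s
    ; lt-trans = λ s t u p q → lt-trans o u t s q p
    ; adj-trans = λ s t u p q a b →
        adj-sym G _ _ (adj-trans o u t s q p (adj-sym G _ _ b) (adj-sym G _ _ a))
    }

  subsingleton : ∀ {S : Subset} → (∀ {x y} → S x → S y → x ≡ y) → Ordering S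
  subsingleton eq = record
    { lt = λ _ _ → ⊥
    ; total = λ s t x≢y → contradiction (eq s t) x≢y
    ; asym = λ _ _ ()
    ; lt-trans = λ _ _ _ ()
    ; adj-trans = λ _ _ _ ()
    }

  -- Memberships are stored so that combinations excluded by disjointness can be refuted without
  -- deciding membership.
  data SumLt (S T : Subset) (R Q : Fin k → Fin k → Set) (x y : Fin k) : Set where
    left  : S x → S y → R x y → SumLt S T R Q x y
    cross : S x → T y → SumLt S T R Q x y
    right : T x → T y → Q x y → SumLt S T R Q x y

  -- The two conditions on adjacency are the mixed cases of transitivity: two vertices in `S` before
  -- one in `T`, and one in `S` before two in `T`.
  sum : ∀ {S T} (o : Ordering S) (p : Ordering T) → Disjoint S T →
        (∀ {x y z} → S x → S y → T z → lt o x y → adj G x y → adj G y z → adj G x z) →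
        (∀ {x y z} → S x → T y → T z → lt p y z → adj G x y → adj G y z → adj G x z) →
        Ordering (S ∪ T)
  sum {S} {T} o p dis sst stt = record
    { lt = _<_ ; total = tot ; asym = λ _ _ → asy
             ; lt-trans = λ _ _ _ → <-trans ; adj-trans = λ _ _ _ → tra }
    where
    _<_ = SumLt S T (lt o) (lt p)

    tot : ∀ {x y} → (S ∪ T) x → (S ∪ T) y → x ≢ y → x < y ⊎ y < x
    tot (inj₁ s) (inj₁ s′) x≢y = [ inj₁ ∘ left s s′ , inj₂ ∘ left s′ s ]′ (total o s s′ x≢y)
    tot (inj₁ s) (inj₂ t) _ = inj₁ (cross s t)
    tot (inj₂ t) (inj₁ s) _ = inj₂ (cross s t)
    tot (inj₂ t) (inj₂ t′) x≢y = [ inj₁ ∘ right t t′ , inj₂ ∘ right t′ t ]′ (total p t t′ x≢y)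

    asy : ∀ {x y} → x < y → ¬ y < x
    asy (left s s′ r) (left _ _ r′) = asym o s s′ r r′
    asy (left s _ _) (cross _ t) = dis s t
    asy (left s _ _) (right _ t _) = dis s t
    asy (cross _ t) (left s _ _) = dis s t
    asy (cross s t) (cross s′ t′) = dis s t′
    asy (cross s _) (right _ t _) = dis s t
    asy (right t _ _) (left _ s _) = dis s t
    asy (right _ t _) (cross s _) = dis s t
    asy (right t t′ q) (right _ _ q′) = asym p t t′ q q′

    <-trans : ∀ {x y z} → x < y → y < z → x < z
    <-trans (left s s′ r) (left _ s″ r′) = left s s″ (lt-trans o s s′ s″ r r′)
    <-trans (left s _ _) (cross _ t) = cross s t
    <-trans (left _ s _) (right t _ _) = contradiction t (dis s)
    <-trans (cross _ t) (left s _ _) = contradiction t (dis s)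
    <-trans (cross _ t) (cross s _) = contradiction t (dis s)
    <-trans (cross s _) (right _ t′ _) = cross s t′
    <-trans (right _ t _) (left s _ _) = contradiction t (dis s)
    <-trans (right _ t _) (cross s _) = contradiction t (dis s)
    <-trans (right t t′ q) (right _ t″ q′) = right t t″ (lt-trans p t t′ t″ q q′)

    tra : ∀ {x y z} → x < y → y < z → adj G x y → adj G y z → adj G x z
    tra (left s s′ r) (left _ s″ r′) = adj-trans o s s′ s″ r r′
    tra (left s s′ r) (cross _ t) = sst s s′ t r
    tra (left _ s _) (right t _ _) = contradiction t (dis s)
    tra (cross _ t) (left s _ _) = contradiction t (dis s)
    tra (cross _ t) (cross s _) = contradiction t (dis s)
    tra (cross s t) (right _ t′ q) = stt s t t′ q
    tra (right _ t _) (left s _ _) = contradiction t (dis s)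
    tra (right _ t _) (cross s _) = contradiction t (dis s)
    tra (right t t′ q) (right _ t″ q′) = adj-trans p t t′ t″ q q′

  -- In a mixed triple the closing pair crosses from `S` to `T`, and so does one of the two given
  -- edges: the former is an edge if the sets are joined, the latter is impossible otherwise.
  uniform-sum : ∀ {S T} → Ordering S → Ordering T → Disjoint S T → Uniform S T → Ordering (S ∪ T)
  uniform-sum o p dis (joined u) =
    sum o p dis (λ s _ t _ _ _ → u s t) (λ s _ t _ _ _ → u s t)
  uniform-sum o p dis (unjoined u) =
    sum o p dis (λ _ s t _ _ a → contradiction a (u s t)) (λ s t _ _ a _ → contradiction a (u s t))

  -- An ordering of S that stays good when a module H is placed after it, or when H is placed
  -- before its dual.
  record OrderingOver (H S : Subset) : Set₁ where
    field
      ordering : Ordering S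
      module-H : ∀ {x h h′} → S x → H h → H h′ → adj G x h → adj G x h′
      upward   : ∀ {x y h} → S x → S y → H h → lt ordering x y →
                 adj G x y → adj G y h → adj G x h
  open OrderingOver

  suborderingOver : ∀ {H S T} → T ⊆ S → OrderingOver H S → OrderingOver H T
  suborderingOver f o = record
    { ordering = subordering f (ordering o)
    ; module-H = λ s → module-H o (f s)
    ; upward = λ s t → upward o (f s) (f t)
    }

  emptyOver : ∀ {H S} → (∀ {x} → ¬ S x) → OrderingOver H S
  emptyOver empty = record
    { ordering = subsingleton (λ s → contradiction s empty)
    ; module-H = λ s → contradiction s empty
    ; upward = λ s → contradiction s empty
    }

  -- One step up a side of a cycle: `R` stands for the leaves hanging off the next higher vertex,
  -- which see the rest of the side and `H` alike.
  extend : ∀ {H R S} → Ordering R → OrderingOver H S → Disjoint R S →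
           Uniform R (S ∪ H) → OrderingOver H (R ∪ S)
  extend {H} {R} {S} o p dis u = record
    { ordering = ordering-sum u
    ; module-H = λ { (inj₁ r) → module-R u r ; (inj₂ s) → module-H p s }
    ; upward = upward-sum u
    }
    where
    -- The uniformity is an argument here so that matching on it unfolds the order.
    ordering-sum : Uniform R (S ∪ H) → Ordering (R ∪ S)
    ordering-sum u = uniform-sum o (ordering p) dis (Uniform-mono id inj₁ u)

    module-R : Uniform R (S ∪ H) → ∀ {x h h′} → R x → H h → H h′ → adj G x h → adj G x h′
    module-R (joined u) r _ h′ _ = u r (inj₂ h′)
    module-R (unjoined u) r h _ a = contradiction a (u r (inj₂ h))

    upward-sum : ∀ (u : Uniform R (S ∪ H)) {x y h} → (R ∪ S) x → (R ∪ S) y → H h →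
                 lt (ordering-sum u) x y → adj G x y → adj G y h → adj G x h
    upward-sum (joined u) _ _ h (left r _ _) _ _ = u r (inj₂ h)
    upward-sum (unjoined u) _ _ h (left _ r _) _ b = contradiction b (u r (inj₂ h))
    upward-sum (joined u) _ _ h (cross r _) _ _ = u r (inj₂ h)
    upward-sum (unjoined u) _ _ h (cross r s) a _ = contradiction a (u r (inj₁ s))
    upward-sum (joined u) _ _ h (right s t q) a b = upward p s t h q a b
    upward-sum (unjoined u) _ _ h (right s t q) a b = upward p s t h q a b

  -- If the sides are joined, an edge from `S` to `H` followed by one from `H` to `T` is closed by
  -- an edge from `S` to `T`, so `H` may stand between them. If not, no such closing edge exists and
  -- both sides must lie on the same side of `H`.
  cycle : ∀ {H S T} → OrderingOver H S → Ordering H → OrderingOver H T →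
          Disjoint S H → Disjoint T H → Disjoint S T → Uniform S T → Ordering (S ∪ (H ∪ T))
  cycle {H} {S} {T} o q p S#H T#H S#T (joined u) =
    sum (ordering o) H+T (λ s → [ S#H s , S#T s ]′) below above
    where
    adjᵒ : ∀ {x y} → adj G x y → adj G y x
    adjᵒ = adj-sym G _ _

    H+T : Ordering (H ∪ T)
    H+T = sum q (dual (ordering p)) (λ h t → T#H t h)
            (λ h h′ t _ _ b → adjᵒ (module-H p t h′ h (adjᵒ b)))
            (λ h t t′ r a b → adjᵒ (upward p t′ t h r (adjᵒ b) (adjᵒ a)))

    below : ∀ {x y z} → S x → S y → (H ∪ T) z → lt (ordering o) x y →
            adj G x y → adj G y z → adj G x z
    below s s′ (inj₁ h) r a b = upward o s s′ h r a b
    below s _ (inj₂ t) _ _ _ = u s t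

    above : ∀ {x y z} → S x → (H ∪ T) y → (H ∪ T) z → lt H+T y z →
            adj G x y → adj G y z → adj G x z
    above s _ _ (left h h′ _) a _ = module-H o s h h′ a
    above s _ _ (cross _ t) _ _ = u s t
    above s _ _ (right _ t _) _ _ = u s t
  cycle {H} {S} {T} o q p S#H T#H S#T (unjoined u) =
    subordering (λ { (inj₁ s) → inj₂ (inj₁ s)
                   ; (inj₂ (inj₁ h)) → inj₁ h
                   ; (inj₂ (inj₂ t)) → inj₂ (inj₂ t) })
      (sum q S+T (λ h → [ (λ s → S#H s h) , (λ t → T#H t h) ]′) below above)
    where
    adjᵒ : ∀ {x y} → adj G x y → adj G y x
    adjᵒ = adj-sym G _ _

    S+T : Ordering (S ∪ T)
    S+T = uniform-sum (dual (ordering o)) (dual (ordering p)) S#T (unjoined u)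

    below : ∀ {x y z} → H x → H y → (S ∪ T) z → lt q x y → adj G x y → adj G y z → adj G x z
    below h h′ (inj₁ s) _ _ b = adjᵒ (module-H o s h′ h (adjᵒ b))
    below h h′ (inj₂ t) _ _ b = adjᵒ (module-H p t h′ h (adjᵒ b))

    above : ∀ {x y z} → H x → (S ∪ T) y → (S ∪ T) z → lt S+T y z →
            adj G x y → adj G y z → adj G x z
    above h _ _ (left s s′ r) a b = adjᵒ (upward o s′ s h r (adjᵒ b) (adjᵒ a))
    above h _ _ (cross s t) _ b = contradiction b (u s t)
    above h _ _ (right t t′ r) a b = adjᵒ (upward p t′ t h r (adjᵒ b) (adjᵒ a))

  Ordering⇒IsComparability : ∀ {S} → (∀ x → S x) → Ordering S → IsComparability G
  Ordering⇒IsComparability all o =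
    (λ x y → adj G x y × lt o x y)
    , (λ _ _ → proj₁)
    , (λ x y a → [ inj₁ ∘ (a ,_) , inj₂ ∘ (adj-sym G x y a ,_) ]′
                   (total o (all x) (all y) λ { refl → adj-irr G x a }))
    , (λ x y (_ , p) (_ , q) → asym o (all x) (all y) p q)
    , λ x y z (a , p) (b , q) →
        adj-trans o (all x) (all y) (all z) p q a b , lt-trans o (all x) (all y) (all z) p q

-- Ancestry in galled-trees

module GalledTree {n : ℕ} (A : Fin n → Fin n → Bool)
  (acyclic : Acyclic A)
  (root : Fin n)
  (root-unique : ∀ v → indeg A v ≡ 0 → v ≡ root)
  (indeg-values : ∀ v → indeg A v ≡ 0 ⊎ indeg A v ≡ 1 ⊎ indeg A v ≡ 2)
  (one-hybrid : ∀ C → BiconnectedComponent A C →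
                ∀ h h′ → HybridOf A C h → HybridOf A C h′ → h ≡ h′)
  where

  open Blocks A

  infix 4 _↝_ _⊏_

  _↝_ : Fin n → Fin n → Set
  _↝_ = Ancestor A

  _⊏_ : Fin n → Fin n → Set
  _⊏_ = TransClosure (Arc A)

  ◅⇒⊏ : ∀ {u c v} → Arc A u c → c ↝ v → u ⊏ v
  ◅⇒⊏ a ε = [ a ]
  ◅⇒⊏ a (b ◅ s) = a ∷ ◅⇒⊏ b s

  no-cycle : ∀ {u c} → Arc A u c → ¬ c ↝ u
  no-cycle a s = acyclic _ (◅⇒⊏ a s)

  arc⇒≢ : ∀ {u c} → Arc A u c → u ≢ c
  arc⇒≢ a refl = no-cycle a ε

  ↝-antisym : ∀ {u v} → u ↝ v → v ↝ u → u ≡ v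
  ↝-antisym ε _ = refl
  ↝-antisym (a ◅ s) t = contradiction (s ◅◅ t) (no-cycle a)

  ↝-snoc : ∀ {u p v} → u ↝ p → Arc A p v → u ↝ v
  ↝-snoc s a = s ◅◅ (a ◅ ε)

  ⊏-isStrictPartialOrder : IsStrictPartialOrder _≡_ _⊏_
  ⊏-isStrictPartialOrder = record
    { isEquivalence = isEquivalence
    ; irrefl = λ { refl s → acyclic _ s }
    ; trans = _++_
    ; <-resp-≈ = (λ { refl s → s }) , λ { refl s → s }
    }

  ⊏-wellFounded : WellFounded _⊏_
  ⊏-wellFounded = spo-wellFounded ⊏-isStrictPartialOrder

  ⊏-noetherian : WellFounded (flip _⊏_)
  ⊏-noetherian = spo-noetherian ⊏-isStrictPartialOrder

  arc? : ∀ u v → Dec (Arc A u v)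
  arc? u v = A u v ≟ᵇ true

  _↝?_ : ∀ u v → Dec (u ↝ v)
  u₀ ↝? v = go u₀ (⊏-noetherian u₀)
    where
    go : ∀ u → Acc (flip _⊏_) u → Dec (u ↝ v)
    go u (acc rs) with u ≟ v
    ... | yes refl = yes ε
    ... | no u≢v = map′ (λ (_ , a , s) → a ◅ s) uncons (any? via)
      where
      uncons : u ↝ v → ∃ λ c → Arc A u c × c ↝ v
      uncons ε = contradiction refl u≢v
      uncons (a ◅ s) = _ , a , s
      via : ∀ c → Dec (Arc A u c × c ↝ v)
      via c with arc? u c
      ... | no ¬a = no (¬a ∘ proj₁)
      ... | yes a = map′ (a ,_) proj₂ (go c (rs [ a ]))

  ↝-unsnoc : ∀ {u v} → u ↝ v → u ≢ v → ∃ λ p → u ↝ p × Arc A p v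
  ↝-unsnoc ε u≢u = contradiction refl u≢u
  ↝-unsnoc {v = v} (_◅_ {j = c} a s) _ with c ≟ v
  ... | yes refl = _ , ε , a
  ... | no c≢v = map₂ (map₁ (a ◅_)) (↝-unsnoc s c≢v)

  -- Every vertex of the path is above `v`, and `w` is not.
  ↝-avoiding : ∀ {u v w} → u ↝ v → ¬ w ↝ v → Avoiding w u v
  ↝-avoiding ε _ = ε
  ↝-avoiding (a ◅ s) ¬w↝v =
    ((λ { refl → ¬w↝v (a ◅ s) }) , (λ { refl → ¬w↝v s }) , inj₁ a) ◅ ↝-avoiding s ¬w↝v

  -- Every vertex of the path is below `u`, and `w` is not.
  ↝-avoiding′ : ∀ {u v w} → u ↝ v → ¬ u ↝ w → Avoiding w u v
  ↝-avoiding′ ε _ = ε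
  ↝-avoiding′ (a ◅ s) ¬u↝w =
    ((λ { refl → ¬u↝w ε }) , (λ { refl → ¬c↝w ε }) , inj₁ a) ◅ ↝-avoiding′ s ¬c↝w
    where ¬c↝w = λ t → ¬u↝w (a ◅ t)

  ∈-parents : ∀ {p v} → Arc A p v → p ∈ filterᵇ (λ u → A u v) (allFinL n)
  ∈-parents {v = v} = ∈-filterᵇ-allFinL (λ u → A u v)

  indeg≢0 : ∀ {p v} → Arc A p v → indeg A v ≢ 0
  indeg≢0 a eq = length≡0⇒∉ eq (∈-parents a)

  -- Climbing from parent to parent stops, and only the root has no parent.
  root-↝ : ∀ v → root ↝ v
  root-↝ v₀ = go v₀ (⊏-wellFounded v₀)
    where
    go : ∀ v → Acc _⊏_ v → root ↝ v
    go v (acc rs) with length-filterᵇ≡0? (λ u → A u v)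
    ... | inj₁ eq with root-unique v eq
    ...   | refl = ε
    go v (acc rs) | inj₂ (p , a) = ↝-snoc (go p (rs [ a ])) a

  avoiding-via-root : ∀ {w u v} → ¬ w ↝ u → ¬ w ↝ v → Avoiding w u v
  avoiding-via-root {u = u} {v} ¬w↝u ¬w↝v =
    Avoiding-sym (↝-avoiding (root-↝ u) ¬w↝u) ◅◅ ↝-avoiding (root-↝ v) ¬w↝v

  parent : ∀ {u v} → ¬ u ↝ v → ∃ λ q → Arc A q u
  parent {u} {v} ¬u↝v with length-filterᵇ≡0? (λ q → A q u)
  ... | inj₂ q = q
  ... | inj₁ eq with root-unique u eq
  ...   | refl = contradiction (root-↝ v) ¬u↝v

  indeg-two : ∀ {p q h} → Arc A p h → Arc A q h → p ≢ q → indeg A h ≡ 2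
  indeg-two {h = h} a b p≢q with indeg-values h
  ... | inj₁ eq = contradiction eq (indeg≢0 a)
  ... | inj₂ (inj₁ eq) =
    contradiction (length≡1⇒≡ eq (∈-parents a) (∈-parents b)) p≢q
  ... | inj₂ (inj₂ eq) = eq

  two-parents : ∀ {p q h s} → Arc A p h → Arc A q h → p ≢ q → Arc A s h → s ≡ p ⊎ s ≡ q
  two-parents a b p≢q c =
    length≡2⇒≡⊎≡ (indeg-two a b p≢q) p≢q
      (∈-parents a) (∈-parents b) (∈-parents c)

  -- Hybrids and the blocks containing them

  Hybrid : Fin n → Set
  Hybrid h = ∃₂ λ p q → Arc A p h × Arc A q h × p ≢ q

  -- u lies strictly inside the cycle closed by h.
  Inner : Fin n → Fin n → Set
  Inner u h = ∃₂ λ p q → Arc A p h × Arc A q h × u ↝ p × ¬ u ↝ q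

  Inner⇒Hybrid : ∀ {u h} → Inner u h → Hybrid h
  Inner⇒Hybrid (p , q , a , b , s , ¬t) = p , q , a , b , λ { refl → ¬t s }

  Inner⇒↝ : ∀ {u h} → Inner u h → u ↝ h
  Inner⇒↝ (_ , _ , a , _ , s , _) = ↝-snoc s a

  Inner-irrefl : ∀ {u} → ¬ Inner u u
  Inner-irrefl (_ , _ , a , _ , s , _) = no-cycle a s

  -- No parent of `h` is below `h`, so the parents stay connected through the root when `h` is
  -- removed; hence all arcs into `h` share one block.
  HybridOf-Block : ∀ {p h} → Arc A p h → Hybrid h → HybridOf A (Block p h) h
  HybridOf-Block {p} {h} a (p₁ , q₁ , a₁ , b₁ , p₁≢q₁) =
    Block-swap (Block-left (inj₂ a)) , indeg-two a₁ b₁ p₁≢q₁ ,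
    λ _ b → Block-swap (Block-adjacent-edge (inj₂ a) (inj₂ b)
              (avoiding-via-root (no-cycle a) (no-cycle b)))

  HybridOf-Block-trans : ∀ {a b c d h} → c ≢ d → Block a b c → Block a b d →
                         HybridOf A (Block c d) h → HybridOf A (Block a b) h
  HybridOf-Block-trans c≢d bc bd (bh , deg , bp) =
    Block-trans c≢d bc bd bh , deg , λ u a → Block-trans c≢d bc bd (bp u a)

  consecutive : ∀ {q u c} → Arc A q u → Arc A u c → Avoiding u q c → Block q u c
  consecutive a b s = Block-swap (Block-adjacent-edge (inj₂ a) (inj₁ b) s)

  -- Arcs above h on one side only lie in the block of h: each consecutive pair is joined
  -- around their common vertex through the root and the other parent of h.
  Inner⇒HybridOf : ∀ {q u h} → Arc A q u → Inner u h → HybridOf A (Block q u) h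
  Inner⇒HybridOf {h = h} e₀ (p , p′ , a , a′ , s₀ , ¬s₀) = go e₀ s₀ ¬s₀
    where
    go : ∀ {q u} → Arc A q u → u ↝ p → ¬ u ↝ p′ → HybridOf A (Block q u) h
    over : ∀ {u c} → Arc A u c → c ↝ h → u ↝ p → ¬ u ↝ p′ → ∀ {q} → Arc A q u → Block q u c
    over b c↝h u↝p ¬u↝p′ e = consecutive e b
      (avoiding-via-root (no-cycle e) ¬u↝p′
       ◅◅ (((λ { refl → ¬u↝p′ ε }) , (λ { refl → no-cycle a u↝p }) , inj₁ a′)
           ◅ Avoiding-sym (↝-avoiding′ c↝h (no-cycle b))))
    Block-right : ∀ {q u} → Arc A q u → Block q u u
    Block-right e = Block-swap (Block-left (inj₂ e))
    go e ε ¬s = HybridOf-Block-trans (arc⇒≢ a) (Block-right e) (over a ε ε ¬s e)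
      (HybridOf-Block a (p , p′ , a , a′ , λ { refl → ¬s ε }))
    go e (b ◅ s) ¬s = HybridOf-Block-trans (arc⇒≢ b) (Block-right e)
      (over b (↝-snoc s a) (b ◅ s) ¬s e) (go b s λ t → ¬s (b ◅ t))

  -- Missing a parent of `h`, the vertex `u` is not the root and some arc enters it. The block of
  -- that arc has both `h` and `h′` as hybrids.
  Inner-unique : ∀ {u h h′} → Inner u h → Inner u h′ → h ≡ h′
  Inner-unique i@(_ , _ , _ , _ , _ , ¬u↝q) i′ with parent ¬u↝q
  ... | _ , e = one-hybrid _ (Block-component (inj₁ e) (arc⇒≢ e)) _ _
                  (Inner⇒HybridOf e i) (Inner⇒HybridOf e i′)

  -- The block of an arc into `u` would have both `u` and `h` as hybrids, but `u` is not inner to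
  -- itself.
  Inner⇒¬Hybrid : ∀ {u h} → Inner u h → ¬ Hybrid u
  Inner⇒¬Hybrid i hyb@(_ , _ , e , _) =
    Inner-irrefl (subst (Inner _) (sym u≡h) i)
    where
    u≡h = one-hybrid _ (Block-component (inj₁ e) (arc⇒≢ e)) _ _
            (HybridOf-Block e hyb) (Inner⇒HybridOf e i)

  -- Climb from `z` to parents that are still below both `a` and `b` until there are none.
  topmost : ∀ {a b z} → a ↝ z → b ↝ z →
            ∃ λ h → h ↝ z × a ↝ h × b ↝ h × (∀ {p} → Arc A p h → a ↝ p → ¬ b ↝ p)
  topmost {a} {b} {z₀} = go z₀ (⊏-wellFounded z₀)
    where
    go : ∀ z → Acc _⊏_ z → a ↝ z → b ↝ z →
         ∃ λ h → h ↝ z × a ↝ h × b ↝ h × (∀ {p} → Arc A p h → a ↝ p → ¬ b ↝ p)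
    go z (acc rs) s t with any? (λ p → arc? p z ×-dec (a ↝? p) ×-dec (b ↝? p))
    ... | yes (p , e , s′ , t′) = map₂ (map₁ (λ u → ↝-snoc u e)) (go p (rs [ e ]) s′ t′)
    ... | no none = z , ε , s , t , λ e s′ t′ → none (_ , e , s′ , t′)

  -- By incomparability the topmost common descendant is neither `a` nor `b`, so each reaches it
  -- through a parent, and no parent of it is below both.
  meeting-hybrid : ∀ {a b z} → ¬ a ↝ b → ¬ b ↝ a → a ↝ z → b ↝ z →
                   ∃ λ h → Inner a h × Inner b h × h ↝ z
  meeting-hybrid ¬ab ¬ba s t with topmost s t
  ... | h , h↝z , a↝h , b↝h , top
    with ↝-unsnoc a↝h (λ { refl → ¬ba b↝h }) | ↝-unsnoc b↝h (λ { refl → ¬ab a↝h })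
  ... | p , a↝p , e | q , b↝q , f =
    h , (p , q , e , f , a↝p , λ a↝q → top f a↝q b↝q)
      , (q , p , f , e , b↝q , top e a↝p) , h↝z

  -- If no child of v is above both x and y, an ancestor w of x and y incomparable with v would
  -- meet v at a hybrid over x and at a hybrid over y; v being inner to both, they coincide.
  lowest-common-ancestor : ∀ {v x y} → v ↝ x → v ↝ y →
                           (∀ {c} → Arc A v c → c ↝ x → ¬ c ↝ y) →
                           ∀ {w} → w ↝ x → w ↝ y → w ↝ v
  lowest-common-ancestor {v} v↝x v↝y split {w} w↝x w↝y with w ↝? v | v ↝? w
  ... | yes w↝v | _ = w↝v
  ... | no _ | yes ε = ε
  ... | no _ | yes (a ◅ s) = contradiction (s ◅◅ w↝y) (split a (s ◅◅ w↝x))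
  ... | no ¬w↝v | no ¬v↝w
    with meeting-hybrid ¬v↝w ¬w↝v v↝x w↝x | meeting-hybrid ¬v↝w ¬w↝v v↝y w↝y
  ... | h , i , _ , h↝x | h′ , i′ , _ , h′↝y with Inner-unique i i′ | Inner⇒↝ i
  ... | refl | ε = contradiction i Inner-irrefl
  ... | refl | a ◅ s = contradiction (s ◅◅ h′↝y) (split a (s ◅◅ h↝x))

  OnCycle : Fin n → Fin n → Set
  OnCycle u h = Hybrid h × (u ≡ h ⊎ Inner u h)

  Inner⇒OnCycle : ∀ {u h} → Inner u h → OnCycle u h
  Inner⇒OnCycle i = Inner⇒Hybrid i , inj₂ i

  OnCycle⇒↝ : ∀ {u h} → OnCycle u h → u ↝ h
  OnCycle⇒↝ (_ , inj₁ refl) = ε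
  OnCycle⇒↝ (_ , inj₂ i) = Inner⇒↝ i

  OnCycle-unique : ∀ {u h h′} → OnCycle u h → OnCycle u h′ → h ≡ h′
  OnCycle-unique (_ , inj₁ refl) (_ , inj₁ refl) = refl
  OnCycle-unique (hyb , inj₁ refl) (_ , inj₂ i) = contradiction hyb (Inner⇒¬Hybrid i)
  OnCycle-unique (_ , inj₂ i) (hyb , inj₁ refl) = contradiction hyb (Inner⇒¬Hybrid i)
  OnCycle-unique (_ , inj₂ i) (_ , inj₂ i′) = Inner-unique i i′

  -- Children of a vertex and the cycles below it

  sibling-over : ∀ {v c d} → Arc A v c → Arc A v d → c ≢ d → c ↝ d → Inner c d
  sibling-over a b c≢d s with ↝-unsnoc s c≢d
  ... | p , c↝p , e = p , _ , e , b , c↝p , no-cycle a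

  -- For comparable siblings the lower one is itself the hybrid, having `v` as its second parent.
  siblings-meet : ∀ {v c d z} → Arc A v c → Arc A v d → c ≢ d → c ↝ z → d ↝ z →
                  ∃ λ h → OnCycle c h × OnCycle d h × h ↝ z
  siblings-meet {c = c} {d} a b c≢d s t with c ↝? d | d ↝? c
  ... | yes c↝d | _ = d , Inner⇒OnCycle i , (Inner⇒Hybrid i , inj₁ refl) , t
    where i = sibling-over a b c≢d c↝d
  ... | no _ | yes d↝c = c , (Inner⇒Hybrid i , inj₁ refl) , Inner⇒OnCycle i , s
    where i = sibling-over b a (≢-sym c≢d) d↝c
  ... | no ¬cd | no ¬dc =
    map₂ (λ (i , j , u) → Inner⇒OnCycle i , Inner⇒OnCycle j , u) (meeting-hybrid ¬cd ¬dc s t)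

  -- As `c` lies on the cycle of one hybrid only, all its overlaps with siblings are below that
  -- hybrid.
  siblings-meet-below : ∀ {v c d z h} → Arc A v c → Arc A v d → c ≢ d → c ↝ z → d ↝ z →
                        OnCycle c h → OnCycle d h × h ↝ z
  siblings-meet-below a b c≢d s t on with siblings-meet a b c≢d s t
  ... | _ , on′ , on″ , u with OnCycle-unique on on′
  ...   | refl = on″ , u

  -- Via v c h s: a path from v through its child c enters h by the parent s of h.
  Via : Fin n → Fin n → Fin n → Fin n → Set
  Via v c h s = Arc A s h × ((c ≡ h × s ≡ v) ⊎ c ↝ s)

  via : ∀ {v c h} → Arc A v c → OnCycle c h → ∃ (Via v c h)
  via e (_ , inj₁ refl) = _ , e , inj₁ (refl , refl)
  via e (_ , inj₂ (p , _ , a , _ , s , _)) = p , a , inj₂ s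

  via⇒↝ : ∀ {v c h s} → Arc A v c → Via v c h s → v ↝ s
  via⇒↝ e (_ , inj₁ (_ , refl)) = ε
  via⇒↝ e (_ , inj₂ t) = e ◅ t

  -- Distinct children both above `s` would overlap in `s`, which would then be below `h` although
  -- it is a parent of `h`.
  via-injective : ∀ {v c d h s} → Arc A v c → Arc A v d → OnCycle c h →
                  Via v c h s → Via v d h s → c ≡ d
  via-injective _ _ _ (_ , inj₁ (refl , refl)) (_ , inj₁ (refl , _)) = refl
  via-injective _ b _ (_ , inj₁ (_ , refl)) (_ , inj₂ t) = contradiction t (no-cycle b)
  via-injective a _ _ (_ , inj₂ t) (_ , inj₁ (_ , refl)) = contradiction t (no-cycle a)
  via-injective {c = c} {d} a b on (e , inj₂ t) (_ , inj₂ t′) with c ≟ d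
  ... | yes c≡d = c≡d
  ... | no c≢d =
    contradiction (proj₂ (siblings-meet-below a b c≢d t t′ on)) (no-cycle e)

  -- Distinct children enter `h` by distinct parents, and `h` has only two.
  at-most-two-on-cycle : ∀ {v c d e h} → Arc A v c → Arc A v d → Arc A v e → c ≢ d →
                         OnCycle c h → OnCycle d h → OnCycle e h → e ≡ c ⊎ e ≡ d
  at-most-two-on-cycle {v} {c} {d} {e} {h} ac ad ae c≢d oc od oe
    with via ac oc | via ad od | via ae oe
  ... | s , vc | t , vd | u , ve
    with two-parents (proj₁ vc) (proj₁ vd)
           (λ s≡t → c≢d (via-injective ac ad oc vc (subst (Via v d h) (sym s≡t) vd)))
           (proj₁ ve)
  ... | inj₁ refl = inj₁ (via-injective ae ac oe ve vc)
  ... | inj₂ refl = inj₂ (via-injective ae ad oe ve vd)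

  -- One parent of `h` is not below `u`, so both children enter `h` by the other.
  inner-child-unique : ∀ {u c d h} → Inner u h → Arc A u c → Arc A u d →
                       OnCycle c h → OnCycle d h → c ≡ d
  inner-child-unique {u} {c} {d} {h} i@(p , q , a , b , s , ¬t) ac ad oc od =
    via-injective ac ad oc (via-p ac oc) (via-p ad od)
    where
    via-p : ∀ {e} → Arc A u e → OnCycle e h → Via u e h p
    via-p ae oe with via ae oe
    ... | w , ve with two-parents a b (λ { refl → ¬t s }) (proj₁ ve)
    ...   | inj₁ refl = ve
    ...   | inj₂ refl = contradiction (via⇒↝ ae ve) ¬t

  Linked : Fin n → Fin n → Set
  Linked c d = ∃ λ z → c ↝ z × d ↝ z

  Linked-sym : ∀ {c d} → Linked c d → Linked d c
  Linked-sym = map₂ swap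

  Linked? : ∀ c d → Dec (Linked c d)
  Linked? c d = any? (λ z → (c ↝? z) ×-dec (d ↝? z))

  -- Both overlaps of `d` belong to the single hybrid whose cycle contains `d`, and that hybrid is
  -- below `c` and `e`.
  Linked-trans : ∀ {v c d e} → Arc A v c → Arc A v d → Arc A v e →
                 Linked c d → Linked d e → Linked c e
  Linked-trans {c = c} {d} {e} ac ad ae (z , c↝z , d↝z) (z′ , d↝z′ , e↝z′) with c ≟ d | d ≟ e
  ... | yes refl | _ = z′ , d↝z′ , e↝z′
  ... | no _ | yes refl = z , c↝z , d↝z
  ... | no c≢d | no d≢e with siblings-meet ac ad c≢d c↝z d↝z
  ...   | h , oc , od , _ =
    h , OnCycle⇒↝ oc , OnCycle⇒↝ (proj₁ (siblings-meet-below ad ae d≢e d↝z′ e↝z′ od))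

  -- Orderings of the leaves below each vertex

  module Explained {k : ℕ} (G : Graph k) (ι : Fin k → Fin n) (t : Fin n → Label)
    (ι-injective : ∀ i j → ι i ≡ ι j → i ≡ j)
    (ι-leaf : ∀ {i c} → ¬ Arc A (ι i) c)
    (explains : ∀ i j → i ≢ j →
       (adj G i j → ∃ λ w → IsLCA A w (ι i) (ι j) × t w ≡ lab1)
     × ((∃ λ w → IsLCA A w (ι i) (ι j) × t w ≡ lab1) → adj G i j))
    where

    open Orders G

    Below : Fin n → Subset
    Below v i = v ↝ ι i

    lab1? : ∀ l → Dec (l ≡ lab1)
    lab1? lab0 = no λ ()
    lab1? lab1 = yes refl
    lab1? labOdot = no λ ()

    -- A test on the children of `v` alone, which by `lowest-common-ancestor` makes `v` the lowest
    -- common ancestor of the two leaves.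
    Split : Fin n → Fin k → Fin k → Set
    Split v i j = v ↝ ι i × v ↝ ι j × (∀ {c} → Arc A v c → c ↝ ι i → ¬ c ↝ ι j)

    -- All these pairs have `v` as their only lowest common ancestor, so `t v` decides their
    -- adjacency at once.
    uniform : ∀ v {S T} → Disjoint S T → (∀ {i j} → S i → T j → Split v i j) → Uniform S T
    uniform v {S} {T} dis split with lab1? (t v)
    ... | yes one = joined adjacent
      where
      adjacent : ∀ {i j} → S i → T j → adj G i j
      adjacent {i} {j} si tj with split si tj
      ... | v↝i , v↝j , none = proj₂ (explains i j λ { refl → dis si tj })
        (v , ((v↝i , v↝j) , λ w (w↝i , w↝j) v↝w →
                ↝-antisym (lowest-common-ancestor v↝i v↝j none w↝i w↝j) v↝w) , one)
    ... | no ¬one = unjoined nonadjacent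
      where
      nonadjacent : ∀ {i j} → S i → T j → ¬ adj G i j
      nonadjacent {i} {j} si tj a
        with split si tj | proj₁ (explains i j λ { refl → dis si tj }) a
      ... | v↝i , v↝j , none | w , ((w↝i , w↝j) , minimal) , one
        with minimal v (v↝i , v↝j) (lowest-common-ancestor v↝i v↝j none w↝i w↝j)
      ... | refl = ¬one one

    -- The leaves off `c` are split at `u` from those below `c`: another child of `u` overlapping
    -- `c` would also lie on the cycle of `h`, against `inner-child-unique`.
    orderingOver-step : ∀ {u c h} → Inner u h → Arc A u c → OnCycle c h → Ordering (Below u) →
                        OrderingOver (Below h) (Below c ∖ Below h) →
                        OrderingOver (Below h) (Below u ∖ Below h)
    orderingOver-step {u} {c} {h} inner e on o p =
      suborderingOver (λ {i} (u↝i , ¬h↝i) → cases u↝i ¬h↝i (c ↝? ι i))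
        (extend (subordering proj₁ o) p (λ (_ , ¬c↝i) (c↝i , _) → ¬c↝i c↝i)
          (Uniform-mono id [ proj₁ , (OnCycle⇒↝ on ◅◅_) ]′ uniform-off-c))
      where
      cases : ∀ {i} → Below u i → ¬ Below h i → Dec (Below c i) →
              ((Below u ∖ Below c) ∪ (Below c ∖ Below h)) i
      cases _ ¬h↝i (yes c↝i) = inj₂ (c↝i , ¬h↝i)
      cases u↝i _ (no ¬c↝i) = inj₁ (u↝i , ¬c↝i)

      uniform-off-c : Uniform (Below u ∖ Below c) (Below c)
      uniform-off-c = uniform u (λ (_ , ¬c↝i) c↝i → ¬c↝i c↝i) λ (u↝i , ¬c↝i) c↝j →
        u↝i , e ◅ c↝j , λ {d} f d↝i d↝j → off ¬c↝i c↝j f d↝i d↝j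
        where
        off : ∀ {i j d} → ¬ Below c i → Below c j → Arc A u d → Below d i → ¬ Below d j
        off {d = d} ¬c↝i c↝j f d↝i d↝j with c ≟ d
        ... | yes refl = ¬c↝i d↝i
        ... | no c≢d = c≢d (inner-child-unique inner e f on
                              (proj₁ (siblings-meet-below e f c≢d c↝j d↝j on)))

    -- Recursion along the path from `u` to its parent of `h`; at `h` itself the side is empty.
    orderingOver : ∀ {u h} → OnCycle u h → (∀ {w} → u ↝ w → Ordering (Below w)) →
                   OrderingOver (Below h) (Below u ∖ Below h)
    orderingOver (_ , inj₁ refl) _ = emptyOver λ (h↝i , ¬h↝i) → ¬h↝i h↝i
    orderingOver {h = h} (hyb , inj₂ (p , q , a , b , s , ¬s)) = go s ¬s
      where
      go : ∀ {u} → u ↝ p → ¬ u ↝ q → (∀ {w} → u ↝ w → Ordering (Below w)) →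
           OrderingOver (Below h) (Below u ∖ Below h)
      go ε ¬s o = orderingOver-step (p , q , a , b , ε , ¬s) a (hyb , inj₁ refl) (o ε)
                    (emptyOver λ (h↝i , ¬h↝i) → ¬h↝i h↝i)
      go (e ◅ s) ¬s o = orderingOver-step (p , q , a , b , e ◅ s , ¬s) e
        (hyb , inj₂ (p , q , a , b , s , ¬s′)) (o ε) (go s ¬s′ (o ∘ (e ◅_)))
        where ¬s′ = λ t → ¬s (e ◅ t)

    orderingCycle : ∀ {v c d h} → Arc A v c → Arc A v d → c ≢ d → OnCycle c h → OnCycle d h →
                    (∀ {w} → v ⊏ w → Ordering (Below w)) → Ordering (Below c ∪ Below d)
    orderingCycle {v} {c} {d} {h} ac ad c≢d oc od o =
      subordering (λ {i} → cases (h ↝? ι i))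
        (cycle (orderingOver oc (o ∘ ◅⇒⊏ ac)) (o (◅⇒⊏ ac (OnCycle⇒↝ oc)))
               (orderingOver od (o ∘ ◅⇒⊏ ad)) proj₂ proj₂ sides-disjoint
               (uniform v sides-disjoint λ (c↝i , ¬h↝i) (d↝j , ¬h↝j) →
                  ac ◅ c↝i , ad ◅ d↝j , λ ae e↝i e↝j →
                    c≢d (trans (only ac ae oc ¬h↝i c↝i e↝i) (sym (only ad ae od ¬h↝j d↝j e↝j)))))
      where
      -- Siblings overlap `c` only below `h`, so a leaf of its side determines the child; hence `v`
      -- splits the two sides.
      only : ∀ {c e i} → Arc A v c → Arc A v e → OnCycle c h → ¬ Below h i →
             Below c i → Below e i → c ≡ e
      only {c} {e} ac ae oc ¬h↝i c↝i e↝i with c ≟ e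
      ... | yes c≡e = c≡e
      ... | no c≢e = contradiction (proj₂ (siblings-meet-below ac ae c≢e c↝i e↝i oc)) ¬h↝i

      sides-disjoint : Disjoint (Below c ∖ Below h) (Below d ∖ Below h)
      sides-disjoint (c↝i , ¬h↝i) (d↝i , _) = c≢d (only ac ad oc ¬h↝i c↝i d↝i)

      cases : ∀ {i} → Dec (Below h i) → (Below c ∪ Below d) i →
              ((Below c ∖ Below h) ∪ (Below h ∪ (Below d ∖ Below h))) i
      cases (yes h↝i) _ = inj₂ (inj₁ h↝i)
      cases (no ¬h↝i) (inj₁ c↝i) = inj₁ (c↝i , ¬h↝i)
      cases (no ¬h↝i) (inj₂ d↝i) = inj₂ (inj₂ (d↝i , ¬h↝i))

    -- The leaves below the class of `c` among the children of `v`, `Linked` being an equivalence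
    -- there.
    BelowLinked : Fin n → Fin n → Subset
    BelowLinked v c i = ∃ λ d → Arc A v d × Linked c d × d ↝ ι i

    -- The class of `c` is either `c` alone or a pair spanning a cycle, by `at-most-two-on-cycle`.
    orderingLinked : ∀ {v c} → Arc A v c → (∀ {w} → v ⊏ w → Ordering (Below w)) →
                     Ordering (BelowLinked v c)
    orderingLinked {v} {c} ac o
      with any? (λ d → ¬? (c ≟ d) ×-dec arc? v d ×-dec Linked? c d)
    ... | no none = subordering alone (o [ ac ])
      where
      alone : BelowLinked v c ⊆ Below c
      alone (e , ae , link , e↝i) with c ≟ e
      ... | yes refl = e↝i
      ... | no c≢e = contradiction (e , c≢e , ae , link) none
    ... | yes (d , c≢d , ad , z , c↝z , d↝z) with siblings-meet ac ad c≢d c↝z d↝z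
    ...   | h , oc , od , _ = subordering both (orderingCycle ac ad c≢d oc od o)
      where
      both : BelowLinked v c ⊆ Below c ∪ Below d
      both (e , ae , (_ , c↝y , e↝y) , e↝i) with c ≟ e
      ... | yes refl = inj₁ e↝i
      ... | no c≢e
        with at-most-two-on-cycle ac ad ae c≢d oc od
               (proj₁ (siblings-meet-below ac ae c≢e c↝y e↝y oc))
      ...   | inj₁ refl = inj₁ e↝i
      ...   | inj₂ refl = inj₂ e↝i

    BelowAny : Fin n → List (Fin n) → Subset
    BelowAny v cs i = ∃ λ c → c ∈ cs × Arc A v c × BelowLinked v c i

    -- Induction over the candidates: a child linked to a later one adds no leaves, and any other
    -- child starts a new class that `v` splits from the rest.
    orderingAny : ∀ v cs → (∀ {w} → v ⊏ w → Ordering (Below w)) → Ordering (BelowAny v cs)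
    orderingAny v [] o = subsingleton λ ()
    orderingAny v (c ∷ cs) o with arc? v c
    ... | no ¬ac = subordering drop (orderingAny v cs o)
      where
      drop : BelowAny v (c ∷ cs) ⊆ BelowAny v cs
      drop (_ , here refl , ac , _) = contradiction ac ¬ac
      drop (d , there d∈cs , rest) = d , d∈cs , rest
    ... | yes ac with Any.any? (λ d → arc? v d ×-dec Linked? d c) cs
    ...   | yes known with find known
    ...     | d , d∈cs , ad , link = subordering merge (orderingAny v cs o)
      where
      merge : BelowAny v (c ∷ cs) ⊆ BelowAny v cs
      merge (_ , here refl , _ , e , ae , link′ , e↝i) =
        d , d∈cs , ad , e , ae , Linked-trans ad ac ae link link′ , e↝i
      merge (e , there e∈cs , rest) = e , e∈cs , rest
    orderingAny v (c ∷ cs) o | yes ac | no fresh =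
      subordering cases (uniform-sum (orderingLinked ac o) (orderingAny v cs o) separate
        (uniform v separate λ { l@(_ , ad , _ , d↝i) r@(_ , _ , _ , _ , ae , _ , e↝j) →
          ad ◅ d↝i , ae ◅ e↝j , λ f f↝i f↝j → apart l r f f↝i f↝j }))
      where
      -- A child `f` above both leaves would link `c` to an entry of `cs`; the case `i` = `j` gives
      -- disjointness.
      apart : ∀ {i j f} → BelowLinked v c i → BelowAny v cs j → Arc A v f →
              Below f i → ¬ Below f j
      apart {i} {j} (_ , ad , c~d , d↝i) (_ , e∈cs , ae , _ , ag , e~g , g↝j) af f↝i f↝j =
        fresh (lose e∈cs (ae , Linked-trans ae af ac
          (Linked-trans ae ag af e~g (ι j , g↝j , f↝j))
          (Linked-trans af ad ac (ι i , f↝i , d↝i) (Linked-sym c~d))))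

      separate : Disjoint (BelowLinked v c) (BelowAny v cs)
      separate l@(_ , ad , _ , d↝i) r = apart l r ad d↝i d↝i

      cases : BelowAny v (c ∷ cs) ⊆ BelowLinked v c ∪ BelowAny v cs
      cases (_ , here refl , _ , l) = inj₁ l
      cases (e , there e∈cs , rest) = inj₂ (e , e∈cs , rest)

    orderingBelow : ∀ v → Acc (flip _⊏_) v → Ordering (Below v)
    orderingBelow v (acc rs) with any? (arc? v)
    -- Only `v` itself is below `v`, and at most one index maps to it.
    ... | no childless = subsingleton λ s t → ι-injective _ _ (trans (sym (at-v s)) (at-v t))
      where
      at-v : ∀ {w} → v ↝ w → v ≡ w
      at-v ε = refl
      at-v (a ◅ _) = contradiction (_ , a) childless
    ... | yes (_ , a) =
      subordering split (orderingAny v (allFin n) λ v⊏w → orderingBelow _ (rs v⊏w))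
      where
      from-child : ∀ {i} w → v ↝ w → w ≡ ι i → BelowAny v (allFin n) i
      from-child w ε refl = contradiction a ι-leaf
      from-child w (_◅_ {j = c} e s) refl =
        c , ∈-allFin c , e , c , e , (c , ε , ε) , s

      split : Below v ⊆ BelowAny v (allFin n)
      split s = from-child _ s refl

    isComparability : IsComparability G
    isComparability = Ordering⇒IsComparability (root-↝ ∘ ι) (orderingBelow root (⊏-noetherian root))

mainTheorem8 : (k : ℕ) (G : Graph k) → IsGaTEx G → IsComparability G
mainTheorem8 k G (n , A , X , ι , t , inj₁ (n≡1 , _) , ι-inj , _) =
  -- In the one-vertex case injectivity of `ι` leaves `G` with at most one vertex.
  Orders.Ordering⇒IsComparability G {S = λ _ → ⊤} _
    (Orders.subsingleton G λ _ _ → ι-inj _ _ (Fin-irrelevant n≡1 _ _))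
  where
  Fin-irrelevant : ∀ {n} → n ≡ 1 → (a b : Fin n) → a ≡ b
  Fin-irrelevant refl zero zero = refl
mainTheorem8 k G (n , A , X , ι , t
                 , inj₂ (acyclic , (root , root-indeg , _ , root-unique , degrees) , leaves , one-hybrid)
                 , ι-inj , ι-onto , ι-X , _ , explains) =
  GalledTree.Explained.isComparability A acyclic root root-unique indeg-values one-hybrid
    G ι t ι-inj
    (λ {i} a → length≡0⇒∉ (proj₁ (proj₁ (leaves (ι i)) (ι-X i))) (∈-filterᵇ-allFinL (A (ι i)) a))
    explains
  where
  -- `X` need not be decidable, but being an image of `ι` is, and the two agree.
  leaf? : ∀ v → Dec (∃ λ i → ι i ≡ v)
  leaf? v = any? λ i → ι i ≟ v

  indeg-values : ∀ v → indeg A v ≡ 0 ⊎ indeg A v ≡ 1 ⊎ indeg A v ≡ 2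
  indeg-values v with v ≟ root | leaf? v
  ... | yes refl | _ = inj₁ root-indeg
  ... | no _ | yes (i , refl) = inj₂ (inj₁ (proj₂ (proj₁ (leaves (ι i)) (ι-X i))))
  ... | no v≢root | no ¬leaf =
    inj₂ ([ inj₁ ∘ proj₁ , inj₂ ∘ proj₁ ]′ (degrees v v≢root (¬leaf ∘ ι-onto v)))
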